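{- Let $S$ be the unique formal power series in the variables $t_1,t_2,\dots$ satisfying $S=1+\sum_{n=1}^\infty t_nS^n$, let $S_1=\sum_{n=1}^\infty t_n$, and let $G=(S-1)/S_1$ (the Geode). Then $G$ is the generating function for nonnegative paths, i.e. $G=\sum_P w(P)$, where the sum is over all nonnegative paths $P$ with steps in $\{ -1,0,1,2,\dots\}$ and $w(P)$ is the weight of $P$.
   Context: A path is a finite (possibly empty) sequence $(s_1,\dots,s_k)$ of integers, called its steps; here all steps are in $\{ -1,0,1,2,\dots\}$. A path is nonnegative if every partial sum $s_1+\cdots+s_i$ ($0\le i\le k$) is nonnegative. The weight of a step $n\ge 0$ is $t_{n+1}$, the weight of the step $-1$ is $1$, and the weight $w(P)$ of a path $P$ is the product of the weights of its steps (the empty path has weight $1$). The generating function for a set of paths is the sum of their weights, as a formal power series in the infinitely many commuting variables $t_1,t_2,\dots$ (arbitrary formal, possibly infinite, linear combinations of monomials). The ring of such power series (over the integers or the rationals) is an integral domain, and $G$ is defined a priori as an element of its field of fractions. -}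

module Defs where

open import Data.Bool.Base using (if_then_else_)
open import Data.Empty using (⊥-elim)
open import Data.Integer.Base as ℤ using (ℤ; 0ℤ; 1ℤ; -1ℤ; +_)
open import Data.List.Base
  using (List; []; _∷_; _++_; map; foldr; replicate; take; upTo; cartesianProductWith)
open import Data.Nat.ListAction using (sum)
open import Data.List.Membership.Propositional using (_∈_)
open import Data.List.Relation.Binary.Pointwise.Base using (Pointwise; []; _∷_)
import Data.List.Relation.Binary.Pointwise as Pointwise
open import Data.List.Relation.Unary.All using (All; []; _∷_)
import Data.List.Relation.Unary.AllPairs as AllPairs
open import Data.List.Relation.Unary.Any using (here)
open import Data.List.Relation.Unary.Unique.Propositional using (Unique)
open import Data.Nat.Base as ℕ using (ℕ; zero; suc)
import Data.Nat.Properties as ℕ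
open import Data.Product.Base using (Σ-syntax; _×_; _,_)
open import Data.Unit.Base using (tt)
open import Relation.Binary.PropositionalEquality
  using (_≡_; _≢_; refl; sym; trans; cong; cong₂)
open import Relation.Nullary using (¬_; Dec; yes; no; does)
open import Relation.Unary using (Pred; U)
open import Level using (0ℓ)

-- A monomial t₁^e₁ t₂^e₂ ⋯ tᵣ^eᵣ is the list e₁ ∷ e₂ ∷ ⋯ ∷ eᵣ ∷ [].
-- Trailing zeros are immaterial, so monomials are compared by _≈ₘ_.

Monomial : Set
Monomial = List ℕ

exponent : Monomial → ℕ → ℕ
exponent []      _       = 0
exponent (e ∷ _) zero    = e
exponent (_ ∷ m) (suc i) = exponent m i

infix 4 _≈ₘ_ _≈ₘ?_

record _≈ₘ_ (a b : Monomial) : Set where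
  constructor same-exponents
  field
    at : ∀ i → exponent a i ≡ exponent b i

open _≈ₘ_ public

≈ₘ-refl : ∀ {a} → a ≈ₘ a
≈ₘ-refl .at i = refl

≈ₘ-sym : ∀ {a b} → a ≈ₘ b → b ≈ₘ a
≈ₘ-sym p .at i = sym (at p i)

≈ₘ-trans : ∀ {a b c} → a ≈ₘ b → b ≈ₘ c → a ≈ₘ c
≈ₘ-trans p q .at i = trans (at p i) (at q i)

∷-cong : ∀ {a b x y} → x ≡ y → a ≈ₘ b → x ∷ a ≈ₘ y ∷ b
∷-cong x≡y a≈b .at zero    = x≡y
∷-cong x≡y a≈b .at (suc i) = at a≈b i

tail-≈ : ∀ {x y a b} → x ∷ a ≈ₘ y ∷ b → a ≈ₘ b
tail-≈ p .at i = at p (suc i)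

0∷-≈ : ∀ {b} → [] ≈ₘ b → [] ≈ₘ 0 ∷ b
0∷-≈ p .at zero    = refl
0∷-≈ p .at (suc i) = at p i

[]-tail-≈ : ∀ {y b} → [] ≈ₘ y ∷ b → [] ≈ₘ b
[]-tail-≈ p .at i = at p (suc i)

[]≈? : ∀ b → Dec ([] ≈ₘ b)
[]≈? []          = yes ≈ₘ-refl
[]≈? (suc y ∷ b) = no (λ p → ℕ.0≢1+n (at p 0))
[]≈? (zero ∷ b) with []≈? b
... | yes p = yes (0∷-≈ p)
... | no ¬p = no (λ q → ¬p ([]-tail-≈ q))

_≈ₘ?_ : ∀ a b → Dec (a ≈ₘ b)
[]      ≈ₘ? b  = []≈? b
(x ∷ a) ≈ₘ? [] with []≈? (x ∷ a)
... | yes p = yes (≈ₘ-sym p)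
... | no ¬p = no (λ q → ¬p (≈ₘ-sym q))
(x ∷ a) ≈ₘ? (y ∷ b) with x ℕ.≟ y | a ≈ₘ? b
... | no ¬p | _     = no (λ q → ¬p (at q 0))
... | yes _ | no ¬q = no (λ q → ¬q (tail-≈ q))
... | yes p | yes q = yes (∷-cong p q)

sumℤ : List ℤ → ℤ
sumℤ = foldr ℤ._+_ 0ℤ

-- Arbitrary integer coefficients: no finiteness in degree or in the variables.

record PowerSeries : Set where
  field
    coeff      : Monomial → ℤ
    coeff-cong : ∀ {a b} → a ≈ₘ b → coeff a ≡ coeff b

open PowerSeries public

infix  4 _≈_ _≃_
infixl 6 _+_ _-_
infixl 7 _*_
infixr 8 _^_

_≈_ : PowerSeries → PowerSeries → Set
F ≈ H = ∀ m → coeff F m ≡ coeff H m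

private
  indicator-cong : ∀ {P Q : Set} (P? : Dec P) (Q? : Dec Q) → (P → Q) → (Q → P) →
                   (if does P? then 1ℤ else 0ℤ) ≡ (if does Q? then 1ℤ else 0ℤ)
  indicator-cong (yes p) (yes q) f g = refl
  indicator-cong (yes p) (no ¬q) f g = ⊥-elim (¬q (f p))
  indicator-cong (no ¬p) (yes q) f g = ⊥-elim (¬p (g q))
  indicator-cong (no ¬p) (no ¬q) f g = refl

monomial : Monomial → PowerSeries
monomial a .coeff m = if does (a ≈ₘ? m) then 1ℤ else 0ℤ
monomial a .coeff-cong {b} {c} b≈c =
  indicator-cong (a ≈ₘ? b) (a ≈ₘ? c)
    (λ p → ≈ₘ-trans p b≈c) (λ p → ≈ₘ-trans p (≈ₘ-sym b≈c))

0# 1# : PowerSeries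
0# .coeff _      = 0ℤ
0# .coeff-cong _ = refl
1# = monomial []

-- The variables are indexed from 0: t₊ k is t_{k+1}.

var : ℕ → Monomial
var k = replicate k 0 ++ 1 ∷ []

t₊ : ℕ → PowerSeries
t₊ k = monomial (var k)

_+_ _-_ : PowerSeries → PowerSeries → PowerSeries
(F + H) .coeff m      = coeff F m ℤ.+ coeff H m
(F + H) .coeff-cong p = cong₂ ℤ._+_ (coeff-cong F p) (coeff-cong H p)
(F - H) .coeff m      = coeff F m ℤ.- coeff H m
(F - H) .coeff-cong p = cong₂ ℤ._-_ (coeff-cong F p) (coeff-cong H p)

-- All factorisations m = a · b, each exactly once (with a and b padded to the
-- length of m).

factorisations : Monomial → List (Monomial × Monomial)
factorisations []      = ([] , []) ∷ []
factorisations (e ∷ m) =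
  cartesianProductWith (λ i (a , b) → i ∷ a , (e ℕ.∸ i) ∷ b)
                       (upTo (suc e)) (factorisations m)

cauchy : (F H : Monomial → ℤ) → Monomial → ℤ
cauchy F H m = sumℤ (map (λ (a , b) → F a ℤ.* H b) (factorisations m))

private
  _≈ₚ_ : Monomial × Monomial → Monomial × Monomial → Set
  (a , b) ≈ₚ (c , d) = a ≈ₘ c × b ≈ₘ d

  cart-cong : ∀ {f g : ℕ → Monomial × Monomial → Monomial × Monomial} is {ps qs} →
              (∀ i {p q} → p ≈ₚ q → f i p ≈ₚ g i q) → Pointwise _≈ₚ_ ps qs →
              Pointwise _≈ₚ_ (cartesianProductWith f is ps) (cartesianProductWith g is qs)
  cart-cong []       h ps = []
  cart-cong (i ∷ is) h ps =
    Pointwise.++⁺ (Pointwise.map⁺ _ _ (Pointwise.map (h i) ps)) (cart-cong is h ps)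

  factorisations-[] : ∀ m → [] ≈ₘ m →
                      Pointwise _≈ₚ_ (factorisations []) (factorisations m)
  factorisations-[] []           p = (≈ₘ-refl , ≈ₘ-refl) ∷ []
  factorisations-[] (suc _ ∷ _) p = ⊥-elim (ℕ.0≢1+n (at p 0))
  factorisations-[] (zero ∷ m)   p with factorisations m | factorisations-[] m ([]-tail-≈ p)
  ... | _ | (q , r) ∷ [] = (0∷-≈ q , 0∷-≈ r) ∷ []

  factorisations-cong : ∀ a b → a ≈ₘ b →
                        Pointwise _≈ₚ_ (factorisations a) (factorisations b)
  factorisations-cong []      b  p = factorisations-[] b p
  factorisations-cong (x ∷ a) [] p =
    Pointwise.symmetric (λ { (q , r) → ≈ₘ-sym q , ≈ₘ-sym r })
      (factorisations-[] (x ∷ a) (≈ₘ-sym p))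
  factorisations-cong (x ∷ a) (y ∷ b) p with at p 0
  ... | refl = cart-cong (upTo (suc x))
                 (λ { i (q , r) → ∷-cong refl q , ∷-cong refl r })
                 (factorisations-cong a b (tail-≈ p))

  sum-cong : ∀ (F H : PowerSeries) {ps qs} → Pointwise _≈ₚ_ ps qs →
             sumℤ (map (λ (a , b) → coeff F a ℤ.* coeff H b) ps) ≡
             sumℤ (map (λ (a , b) → coeff F a ℤ.* coeff H b) qs)
  sum-cong F H []             = refl
  sum-cong F H ((q , r) ∷ ps) =
    cong₂ ℤ._+_ (cong₂ ℤ._*_ (coeff-cong F q) (coeff-cong H r)) (sum-cong F H ps)

_*_ : PowerSeries → PowerSeries → PowerSeries
(F * H) .coeff                = cauchy (coeff F) (coeff H)
(F * H) .coeff-cong {a} {b} p = sum-cong F H (factorisations-cong a b p)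

_^_ : PowerSeries → ℕ → PowerSeries
F ^ zero  = 1#
F ^ suc n = F * F ^ n

-- HasSum A f F says that F is the (possibly infinite) formal sum of f i over all
-- i satisfying A: for each monomial only finitely many of these f i contribute,
-- and their coefficients add up to that of F.  The list may also contain
-- non-contributing indices.

HasSum : {I : Set} → Pred I 0ℓ → (I → PowerSeries) → PowerSeries → Set
HasSum {I} A f F =
  ∀ m → Σ[ is ∈ List I ]
    Unique is
    × All A is
    × (∀ i → A i → coeff (f i) m ≢ 0ℤ → i ∈ is)
    × coeff F m ≡ sumℤ (map (λ i → coeff (f i) m) is)

-- S = 1 + Σ_{n ≥ 1} tₙ Sⁿ, with n = k + 1.

SatisfiesSEquation : PowerSeries → Set
SatisfiesSEquation S =
  Σ[ F ∈ PowerSeries ] HasSum U (λ k → t₊ k * S ^ suc k) F × S ≈ 1# + F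

private
  degree-cong : ∀ a b → a ≈ₘ b → sum a ≡ sum b
  degree-cong []      []      p = refl
  degree-cong []      (y ∷ b) p = cong₂ ℕ._+_ (at p 0) (degree-cong [] b ([]-tail-≈ p))
  degree-cong (x ∷ a) []      p = cong₂ ℕ._+_ (at p 0) (degree-cong a [] (≈ₘ-sym ([]-tail-≈ (≈ₘ-sym p))))
  degree-cong (x ∷ a) (y ∷ b) p = cong₂ ℕ._+_ (at p 0) (degree-cong a b (tail-≈ p))

-- S₁ = Σ_{n ≥ 1} tₙ, given by its coefficients: 1 on the monomials of degree 1
-- and 0 elsewhere.  S₁-hasSum justifies this.

S₁ : PowerSeries
S₁ .coeff m = if does (sum m ℕ.≟ 1) then 1ℤ else 0ℤ
S₁ .coeff-cong {a} {b} p = cong (λ d → if does (d ℕ.≟ 1) then 1ℤ else 0ℤ) (degree-cong a b p)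

private
  degree-var : ∀ k → sum (var k) ≡ 1
  degree-var zero    = refl
  degree-var (suc k) = degree-var k

  degree-0 : ∀ m → sum m ≡ 0 → [] ≈ₘ m
  degree-0 []         p = ≈ₘ-refl
  degree-0 (zero ∷ m) p = 0∷-≈ (degree-0 m p)

  degree-1 : ∀ m → sum m ≡ 1 → Σ[ k ∈ ℕ ] var k ≈ₘ m
  degree-1 (suc zero ∷ m) p = 0 , ∷-cong refl (degree-0 m (ℕ.suc-injective p))
  degree-1 (zero ∷ m)     p with degree-1 m p
  ... | k , q = suc k , ∷-cong refl q

  var-injective : ∀ j k → var j ≈ₘ var k → j ≡ k
  var-injective zero    zero    p = refl
  var-injective zero    (suc k) p = ⊥-elim (ℕ.1+n≢0 (at p 0))
  var-injective (suc j) zero    p = ⊥-elim (ℕ.0≢1+n (at p 0))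
  var-injective (suc j) (suc k) p = cong suc (var-injective j k (tail-≈ p))

  indicator-yes : ∀ {P : Set} (P? : Dec P) → P → (if does P? then 1ℤ else 0ℤ) ≡ 1ℤ
  indicator-yes (yes _) p = refl
  indicator-yes (no ¬p) p = ⊥-elim (¬p p)

  indicator-no : ∀ {P : Set} (P? : Dec P) → ¬ P → (if does P? then 1ℤ else 0ℤ) ≡ 0ℤ
  indicator-no (yes p) ¬p = ⊥-elim (¬p p)
  indicator-no (no _)  ¬p = refl

  t₊-support : ∀ k m → coeff (t₊ k) m ≢ 0ℤ → var k ≈ₘ m
  t₊-support k m ne with var k ≈ₘ? m
  ... | yes p = p
  ... | no  _ = ⊥-elim (ne refl)

S₁-hasSum : HasSum U t₊ S₁
S₁-hasSum m = by-degree (sum m ℕ.≟ 1)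
  where
  by-degree : Dec (sum m ≡ 1) → _
  by-degree (no ¬d) =
    [] , AllPairs.[] , [] ,
    (λ k _ ne → ⊥-elim (¬d (trans (sym (degree-cong (var k) m (t₊-support k m ne)))
                                  (degree-var k)))) ,
    indicator-no (sum m ℕ.≟ 1) ¬d
  by-degree (yes d) with degree-1 m d
  ... | k , p =
    k ∷ [] , ([] AllPairs.∷ AllPairs.[]) , (tt ∷ []) ,
    (λ j _ ne → here (var-injective j k (≈ₘ-trans (t₊-support j m ne) (≈ₘ-sym p)))) ,
    trans (indicator-yes (sum m ℕ.≟ 1) d)
          (sym (cong (ℤ._+ 0ℤ) (indicator-yes (var k ≈ₘ? m) p)))

S₁≉0 : ¬ S₁ ≈ 0#
S₁≉0 p with p (1 ∷ [])
... | ()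

-- The field of fractions of the integral domain of power series, as a setoid.

record Fraction : Set where
  constructor _/_⟨_⟩
  field
    num   : PowerSeries
    den   : PowerSeries
    den≉0 : ¬ den ≈ 0#

open Fraction public

_≃_ : Fraction → Fraction → Set
x ≃ y = num x * den y ≈ num y * den x

1≉0 : ¬ 1# ≈ 0#
1≉0 p with p []
... | ()

ι : PowerSeries → Fraction
ι F = F / 1# ⟨ 1≉0 ⟩

geode : PowerSeries → Fraction
geode S = (S - 1#) / S₁ ⟨ S₁≉0 ⟩

data Step : Set where
  down : Step
  up   : ℕ → Step

⟦_⟧ : Step → ℤ
⟦ down ⟧ = -1ℤ
⟦ up n ⟧ = + n

Path : Set
Path = List Step

Nonnegative : Pred Path 0ℓ
Nonnegative P = ∀ i → 0ℤ ℤ.≤ sumℤ (map ⟦_⟧ (take i P))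

stepWeight : Step → PowerSeries
stepWeight down   = 1#
stepWeight (up n) = t₊ n

weight : Path → PowerSeries
weight P = foldr _*_ 1# (map stepWeight P)

IsGeneratingFunction : Pred Path 0ℓ → PowerSeries → Set
IsGeneratingFunction A F = HasSum A weight F

{-# OPTIONS --safe #-}
module Submission where

-- Put Σ F = Σ_{k ≥ 0} t₊ k · F k and g h = 1 + S + ⋯ + S^(h − 1), so S = 1 + Σ S^(k+1).
-- Let N solve N = 1 + Σ N g (k+1); both equations have a unique solution because Σ raises
-- degrees.  Since S g (k+1) + 1 = g (k+1) + S^(k+1), multiplying N by S gives S₁ N = S − 1.
-- It follows that E h = N g h satisfies E (h+1) = 1 + E h + Σ E (h+1+k), which, together
-- with E 0 = 0, is the first-step recursion for paths that start at height h and stay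
-- positive.  Hence N = E 1 is the generating function for nonnegative paths.

open import Algebra.Bundles using (CommutativeRing)
open import Data.Bool.Base using (if_then_else_)
import Data.Integer.Base as ℤ renaming (+_ to fromℕ)
open ℤ using (ℤ; 0ℤ; 1ℤ; -1ℤ)
import Data.Integer.Properties as ℤ
import Data.Integer.Tactic.RingSolver as ℤ
open import Data.List.Base
  using (List; []; _∷_; _++_; _∷ʳ_; map; concat; filter; length; take; upTo; applyUpTo; cartesianProductWith)
open import Data.List.Membership.Propositional using (_∈_)
open import Data.List.Membership.Propositional.Properties
  using (∈-filter⁺; ∈-filter⁻; ∈-upTo⁺; ∈-map⁺; ∈-map⁻; ∈-++⁺ˡ; ∈-++⁺ʳ; ∈-concat⁺′; ∈-concat⁻′)
open import Data.List.Membership.Propositional.Properties.WithK using (unique∧set⇒bag)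
open import Data.List.Properties
  using (map-++; map-∘; map-cong; map-upTo; upTo-∷ʳ; ∷-injectiveˡ; ∷-injectiveʳ)
open import Data.List.Relation.Binary.BagAndSetEquality using (∼bag⇒↭)
open import Data.List.Relation.Binary.Disjoint.Propositional using (Disjoint)
open import Data.List.Relation.Binary.Permutation.Propositional using (_↭_; ↭⇒↭ₛ)
open import Data.List.Relation.Binary.Permutation.Propositional.Properties using (map⁺)
open import Data.List.Relation.Binary.Permutation.Setoid.Properties using (foldr-commMonoid)
open import Data.List.Relation.Binary.Pointwise using (Pointwise; []; _∷_; Pointwise-length)
open import Data.List.Relation.Unary.All as All using (All)
import Data.List.Relation.Unary.All.Properties as All
import Data.List.Relation.Unary.AllPairs as AllPairs
import Data.List.Relation.Unary.AllPairs.Properties as AllPairs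
open import Data.List.Relation.Unary.Any using (here; there)
open import Data.List.Relation.Unary.Unique.Propositional using (Unique)
import Data.List.Relation.Unary.Unique.Propositional.Properties as Unique
open import Data.Maybe.Base as Maybe using (Maybe; just; nothing; maybe′)
open import Data.Maybe.Properties using (maybe′-map)
open import Data.Nat.Base as ℕ using (ℕ; zero; suc; z≤n; s≤s)
open import Data.Nat.ListAction using (sum)
import Data.Nat.Properties as ℕ
open import Data.Product using (_,_)
open import Function.Base using (_∘_; flip; const)
open import Function.Bundles using (mk⇔)
open import Level using (0ℓ)
import Relation.Binary.PropositionalEquality as ≡
open import Relation.Nullary.Decidable using (yes; no; does-⇔; dec-false; ¬?)
open import Relation.Nullary.Negation using (¬_; contradiction)
open import Relation.Unary using (Pred; U)

-- The equation for N and the formula for E h come from first passages. A path that falls below its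
-- starting height only at its last step is a single down step, or `up k` followed by k + 1 such
-- passages; hence S is the generating function of these paths. A path that stays positive from
-- height h has a lowest level l with 1 ≤ l ≤ h: it descends to l by h - l first passages and goes
-- on as a nonnegative path, so E h = N g h. Looking at the first step from height 1 then gives the
-- equation for N. This decomposition only motivates the formulas: they are verified algebraically,
-- and actual paths enter through the first-step recursion alone. That S₁ divides S - 1 is not
-- evident beforehand, so N is built without division and the quotient is checked by
-- cross-multiplication. Of the infinite sum the identities use only congruence, additivity and
-- compatibility with multiplication, so they can be stated in any commutative ring.

-- Identities in a commutative ring

module RingSums {c ℓ} (R : CommutativeRing c ℓ) where
  open CommutativeRing R
  open import Algebra.Properties.CommutativeSemigroup +-commutativeSemigroup using (interchange)

  sumBelow : (ℕ → Carrier) → ℕ → Carrier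
  sumBelow f zero    = 0#
  sumBelow f (suc n) = sumBelow f n + f n

  sumBelow-cong : ∀ {f g} n → (∀ k → f k ≈ g k) → sumBelow f n ≈ sumBelow g n
  sumBelow-cong zero    f≈g = refl
  sumBelow-cong (suc n) f≈g = +-cong (sumBelow-cong n f≈g) (f≈g n)

  sumBelow-+ : ∀ f g n → sumBelow (λ k → f k + g k) n ≈ sumBelow f n + sumBelow g n
  sumBelow-+ f g zero    = sym (+-identityˡ 0#)
  sumBelow-+ f g (suc n) = trans (+-congʳ (sumBelow-+ f g n)) (interchange _ _ _ _)

  sumBelow-*ʳ : ∀ f x n → sumBelow f n * x ≈ sumBelow (λ k → f k * x) n
  sumBelow-*ʳ f x zero    = zeroˡ x
  sumBelow-*ʳ f x (suc n) = trans (distribʳ x _ _) (+-congʳ (sumBelow-*ʳ f x n))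

-- In GeodeIdentities, D f stands for Σ_{k ≥ 0} t₊ k · f k and power for the powers of s.

module GeodeAlgebra {c ℓ} (R : CommutativeRing c ℓ) where
  open CommutativeRing R
  open import Algebra.Properties.Ring ring using (+-cancelˡ)
  open import Algebra.Solver.Ring.NaturalCoefficients.Default commutativeSemiring
  open import Relation.Binary.Reasoning.Setoid setoid

  geometric : Carrier → ℕ → Carrier
  geometric s zero    = 0#
  geometric s (suc n) = 1# + s * geometric s n

  module GeometricSum
    (s : Carrier) (power : ℕ → Carrier)
    (power-zero : power 0 ≈ 1#) (power-suc : ∀ n → power (suc n) ≈ s * power n)
    where

    private
      g : ℕ → Carrier
      g = geometric s

    -- Telescoping: both sides are 1 + s + ⋯ + s^n. Written without subtraction, it stays within
    -- reach of the semiring solver.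
    geometric-power : ∀ n → s * g n + 1# ≈ g n + power n
    geometric-power zero    = +-cong (zeroʳ s) (sym power-zero)
    geometric-power (suc n) = begin
      s * (1# + s * g n) + 1#        ≈⟨ solve 2 (λ s g → s :* (con 1 :+ s :* g) :+ con 1 :=
                                                        s :* (s :* g :+ con 1) :+ con 1) refl s (g n) ⟩
      s * (s * g n + 1#) + 1#        ≈⟨ +-congʳ (*-congˡ (geometric-power n)) ⟩
      s * (g n + power n) + 1#       ≈⟨ solve 3 (λ s g p → s :* (g :+ p) :+ con 1 :=
                                                        con 1 :+ s :* g :+ s :* p) refl s (g n) (power n) ⟩
      1# + s * g n + s * power n     ≈⟨ +-congˡ (power-suc n) ⟨
      1# + s * g n + power (suc n)   ∎

    geometric-+ : ∀ m n → g (m ℕ.+ n) ≈ g m + power m * g n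
    geometric-+ zero    n = sym (trans (+-identityˡ _) (trans (*-congʳ power-zero) (*-identityˡ (g n))))
    geometric-+ (suc m) n = begin
      1# + s * g (m ℕ.+ n)                ≈⟨ +-congˡ (*-congˡ (geometric-+ m n)) ⟩
      1# + s * (g m + power m * g n)      ≈⟨ solve 4 (λ s g p h → con 1 :+ s :* (g :+ p :* h) :=
                                                     con 1 :+ s :* g :+ s :* p :* h) refl s (g m) (power m) (g n) ⟩
      1# + s * g m + s * power m * g n    ≈⟨ +-congˡ (*-congʳ (power-suc m)) ⟨
      g (suc m) + power (suc m) * g n     ∎

  module GeodeIdentities
    (s : Carrier) (power : ℕ → Carrier)
    (power-zero : power 0 ≈ 1#) (power-suc : ∀ n → power (suc n) ≈ s * power n)
    (D : (ℕ → Carrier) → Carrier)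
    (D-cong : ∀ f h → (∀ k → f k ≈ h k) → D f ≈ D h)
    (D-+ : ∀ f h → D (λ k → f k + h k) ≈ D f + D h)
    (D-*ʳ : ∀ f x → D f * x ≈ D (λ k → f k * x))
    (s-equation : s ≈ 1# + D (λ k → power (suc k)))
    (n : Carrier)
    (n-equation : n ≈ 1# + D (λ k → n * geometric s (suc k)))
    where

    open GeometricSum s power power-zero power-suc

    private
      g : ℕ → Carrier
      g = geometric s

      x y z : Carrier
      x = D (λ k → n * g (suc k))
      y = D (λ k → power (suc k))
      z = D (const n)

    -- Expanding D (n · g (k+1)) · s in two ways.
    D-const : z ≈ y
    -- The summand `z` is added to `x * s` so that each term becomes `n * (s * g (suc k) + 1#)`, to
    -- which `geometric-power` applies. Both expansions then share `x + x * y`.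
    D-const = +-cancelˡ (x + x * y) z y (begin
      x + x * y + z          ≈⟨ solve 3 (λ x y z → x :+ x :* y :+ z := x :* (con 1 :+ y) :+ z) refl x y z ⟩
      x * (1# + y) + z       ≈⟨ +-congʳ (*-congˡ s-equation) ⟨
      x * s + z              ≈⟨ +-congʳ (D-*ʳ _ s) ⟩
      D (λ k → n * g (suc k) * s) + z       ≈⟨ D-+ _ _ ⟨
      D (λ k → n * g (suc k) * s + n)       ≈⟨ D-cong _ _ step ⟩
      D (λ k → n * g (suc k) + power (suc k) * n)  ≈⟨ D-+ _ _ ⟩
      x + D (λ k → power (suc k) * n)       ≈⟨ +-congˡ (D-*ʳ _ n) ⟨
      x + y * n              ≈⟨ +-congˡ (*-congˡ n-equation) ⟩
      x + y * (1# + x)       ≈⟨ solve 2 (λ x y → x :+ y :* (con 1 :+ x) := x :+ x :* y :+ y) refl x y ⟩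
      x + x * y + y          ∎)
      where
      step : ∀ k → n * g (suc k) * s + n ≈ n * g (suc k) + power (suc k) * n
      step k = begin
        n * g (suc k) * s + n               ≈⟨ solve 3 (λ n g s → n :* g :* s :+ n :=
                                                 n :* (s :* g :+ con 1)) refl n (g (suc k)) s ⟩
        n * (s * g (suc k) + 1#)            ≈⟨ *-congˡ (geometric-power (suc k)) ⟩
        n * (g (suc k) + power (suc k))     ≈⟨ solve 3 (λ n g p → n :* (g :+ p) := n :* g :+ p :* n)
                                                 refl n (g (suc k)) (power (suc k)) ⟩
        n * g (suc k) + power (suc k) * n   ∎

    -- This is `D-const` in another form: `D (const 1#) * n` is `z`, and `y` is `s - 1#` by the
    -- equation for `s`.
    geode-identity : n * g 1 * D (const 1#) ≈ s - 1#
    geode-identity = begin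
      n * g 1 * D (const 1#)    ≈⟨ *-comm (n * g 1) _ ⟩
      D (const 1#) * (n * g 1)  ≈⟨ *-congˡ (*-congˡ (trans (+-congˡ (zeroʳ s)) (+-identityʳ 1#))) ⟩
      D (const 1#) * (n * 1#)   ≈⟨ *-congˡ (*-identityʳ n) ⟩
      D (const 1#) * n          ≈⟨ D-*ʳ _ n ⟩
      D (λ k → 1# * n)          ≈⟨ D-cong _ _ (λ k → *-identityˡ n) ⟩
      z                         ≈⟨ D-const ⟩
      y                         ≈⟨ +-identityʳ y ⟨
      y + 0#                    ≈⟨ +-congˡ (-‿inverseʳ 1#) ⟨
      y + (1# - 1#)             ≈⟨ +-assoc y 1# (- 1#) ⟨
      y + 1# - 1#               ≈⟨ +-congʳ (trans (+-comm y 1#) (sym s-equation)) ⟩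
      s - 1#                    ∎

    -- Splitting the geometric sum after its first `h` terms turns the infinite sum into
    -- `z * g h + x * power h`. Since `z` equals `y`, the constant 1 combines with `y * g h` to
    -- `power h`, and the two multiples of `power h` combine through `1# + x`, which is `n`.
    n*geometric-suc : ∀ h → n * g (suc h) ≈ 1# + n * g h + D (λ k → n * g (suc h ℕ.+ k))
    n*geometric-suc h = sym (begin
      1# + n * g h + D (λ k → n * g (suc h ℕ.+ k))
        ≈⟨ +-congˡ (D-cong _ _ split) ⟩
      1# + n * g h + D (λ k → n * g h + n * g (suc k) * power h)
        ≈⟨ +-congˡ (trans (D-+ _ _) (+-cong (sym (D-*ʳ _ (g h))) (sym (D-*ʳ _ (power h))))) ⟩
      1# + n * g h + (z * g h + x * power h)
        ≈⟨ +-congˡ (+-congʳ (*-congʳ D-const)) ⟩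
      1# + n * g h + (y * g h + x * power h)
        ≈⟨ solve 5 (λ n g x y p → con 1 :+ n :* g :+ (y :* g :+ x :* p) :=
                     y :* g :+ con 1 :+ n :* g :+ x :* p) refl n (g h) x y (power h) ⟩
      y * g h + 1# + n * g h + x * power h
        ≈⟨ +-congʳ (+-congʳ y*g+1) ⟩
      power h + n * g h + x * power h
        ≈⟨ solve 4 (λ n g x p → p :+ n :* g :+ x :* p := n :* g :+ (con 1 :+ x) :* p) refl n (g h) x (power h) ⟩
      n * g h + (1# + x) * power h
        ≈⟨ +-congˡ (*-congʳ n-equation) ⟨
      n * g h + n * power h
        ≈⟨ distribˡ n _ _ ⟨
      n * (g h + power h)
        ≈⟨ *-congˡ (trans (sym (geometric-power h)) (+-comm _ 1#)) ⟩
      n * g (suc h) ∎)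
      where
      split : ∀ k → n * g (suc h ℕ.+ k) ≈ n * g h + n * g (suc k) * power h
      split k = begin
        n * g (suc h ℕ.+ k)                      ≈⟨ *-congˡ (reflexive (≡.cong g (ℕ.+-suc h k))) ⟨
        n * g (h ℕ.+ suc k)                      ≈⟨ *-congˡ (geometric-+ h (suc k)) ⟩
        n * (g h + power h * g (suc k))          ≈⟨ solve 4 (λ n g p j → n :* (g :+ p :* j) := n :* g :+ n :* j :* p)
                                                      refl n (g h) (power h) (g (suc k)) ⟩
        n * g h + n * g (suc k) * power h        ∎

      -- As `1# + y` is `s`, this is the closed form (s - 1) g h = s^h - 1.
      y*g+1 : y * g h + 1# ≈ power h
      y*g+1 = +-cancelˡ (g h) _ _ (begin
        g h + (y * g h + 1#)    ≈⟨ solve 2 (λ g y → g :+ (y :* g :+ con 1) := (con 1 :+ y) :* g :+ con 1) refl (g h) y ⟩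
        (1# + y) * g h + 1#     ≈⟨ +-congʳ (*-congʳ s-equation) ⟨
        s * g h + 1#            ≈⟨ geometric-power h ⟩
        g h + power h           ∎)

open import Defs
open import Data.Product using (∃!; Σ-syntax; _×_)
open import Relation.Binary.PropositionalEquality

-- The Cauchy product

sum-++ : ∀ xs ys → sumℤ (xs ++ ys) ≡ sumℤ xs ℤ.+ sumℤ ys
sum-++ []       ys = sym (ℤ.+-identityˡ _)
sum-++ (x ∷ xs) ys = trans (cong (x ℤ.+_) (sum-++ xs ys)) (sym (ℤ.+-assoc x _ _))

sum-cartesianProductWith :
  ∀ {A B C : Set} (g : C → ℤ) (f : A → B → C) xs ys →
  sumℤ (map g (cartesianProductWith f xs ys)) ≡
  sumℤ (map (λ x → sumℤ (map (g ∘ f x) ys)) xs)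
sum-cartesianProductWith g f []       ys = refl
sum-cartesianProductWith g f (x ∷ xs) ys = begin
  sumℤ (map g (map (f x) ys ++ rest))
    ≡⟨ cong sumℤ (map-++ g (map (f x) ys) rest) ⟩
  sumℤ (map g (map (f x) ys) ++ map g rest)
    ≡⟨ sum-++ (map g (map (f x) ys)) (map g rest) ⟩
  sumℤ (map g (map (f x) ys)) ℤ.+ sumℤ (map g rest)
    ≡⟨ cong₂ ℤ._+_ (cong sumℤ (sym (map-∘ ys))) (sum-cartesianProductWith g f xs ys) ⟩
  _ ∎
  where
  open ≡-Reasoning
  rest = cartesianProductWith f xs ys

-- The sum over i + j = n. Giving `φ` both indices, instead of i and n ∸ i, keeps truncated
-- subtraction out of the laws and makes commutativity a matter of `flip`.
convolve : (ℕ → ℕ → ℤ) → ℕ → ℤ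
convolve φ zero    = φ 0 0
convolve φ (suc n) = φ 0 (suc n) ℤ.+ convolve (φ ∘ suc) n

convolve-cong : ∀ {φ ψ} n → (∀ {i j} → i ℕ.≤ n → j ℕ.≤ n → φ i j ≡ ψ i j) →
                convolve φ n ≡ convolve ψ n
convolve-cong zero    eq = eq z≤n z≤n
convolve-cong (suc n) eq =
  cong₂ ℤ._+_ (eq z≤n ℕ.≤-refl) (convolve-cong n λ i≤n j≤n → eq (s≤s i≤n) (ℕ.m≤n⇒m≤1+n j≤n))

convolve-+ : ∀ φ ψ n →
             convolve (λ i j → φ i j ℤ.+ ψ i j) n ≡ convolve φ n ℤ.+ convolve ψ n
convolve-+ φ ψ zero    = refl
convolve-+ φ ψ (suc n) =
  trans (cong (φ 0 (suc n) ℤ.+ ψ 0 (suc n) ℤ.+_) (convolve-+ (φ ∘ suc) (ψ ∘ suc) n))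
        (interchange (φ 0 (suc n)) (ψ 0 (suc n)) _ _)
  where
  interchange : ∀ a b c d → a ℤ.+ b ℤ.+ (c ℤ.+ d) ≡ a ℤ.+ c ℤ.+ (b ℤ.+ d)
  interchange = ℤ.solve-∀

convolve-0 : ∀ {φ} n → (∀ i j → φ i j ≡ 0ℤ) → convolve φ n ≡ 0ℤ
convolve-0 zero    eq = eq 0 0
convolve-0 (suc n) eq = cong₂ ℤ._+_ (eq 0 (suc n)) (convolve-0 n (eq ∘ suc))

convolve-head : ∀ {φ} n → (∀ i j → φ (suc i) j ≡ 0ℤ) → convolve φ n ≡ φ 0 n
convolve-head zero    eq = refl
convolve-head {φ} (suc n) eq = trans (cong (φ 0 (suc n) ℤ.+_) (convolve-0 n eq)) (ℤ.+-identityʳ _)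

convolve-last : ∀ φ n →
                convolve φ (suc n) ≡ convolve (λ i j → φ i (suc j)) n ℤ.+ φ (suc n) 0
convolve-last φ zero    = refl
convolve-last φ (suc n) =
  trans (cong (φ 0 (suc (suc n)) ℤ.+_) (convolve-last (φ ∘ suc) n)) (sym (ℤ.+-assoc (φ 0 (suc (suc n))) _ _))

convolve-flip : ∀ φ n → convolve φ n ≡ convolve (flip φ) n
convolve-flip φ zero    = refl
convolve-flip φ (suc n) = begin
  φ 0 (suc n) ℤ.+ convolve (φ ∘ suc) n
    ≡⟨ cong (φ 0 (suc n) ℤ.+_) (convolve-flip (φ ∘ suc) n) ⟩
  φ 0 (suc n) ℤ.+ convolve (flip (φ ∘ suc)) n
    ≡⟨ ℤ.+-comm (φ 0 (suc n)) _ ⟩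
  convolve (flip (φ ∘ suc)) n ℤ.+ φ 0 (suc n)
    ≡⟨ convolve-last (flip φ) n ⟨
  convolve (flip φ) (suc n) ∎
  where open ≡-Reasoning

-- Both sides run over all triples with sum `n`. The induction step separates the triples with first
-- entry 0, which form `convolve (ψ 0) (suc n)`, from the others.
convolve-assoc : ∀ (ψ : ℕ → ℕ → ℕ → ℤ) n →
                 convolve (λ i k → convolve (λ a b → ψ a b k) i) n ≡
                 convolve (λ a i → convolve (ψ a) i) n
convolve-assoc ψ zero    = refl
convolve-assoc ψ (suc n) = begin
  ψ 0 0 (suc n) ℤ.+ convolve (λ i k → ψ 0 (suc i) k ℤ.+ convolve (λ a b → ψ (suc a) b k) i) n
    ≡⟨ cong (ψ 0 0 (suc n) ℤ.+_) (convolve-+ (ψ 0 ∘ suc) _ n) ⟩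
  ψ 0 0 (suc n) ℤ.+ (convolve (ψ 0 ∘ suc) n ℤ.+ convolve (λ i k → convolve (λ a b → ψ (suc a) b k) i) n)
    ≡⟨ ℤ.+-assoc (ψ 0 0 (suc n)) _ _ ⟨
  convolve (ψ 0) (suc n) ℤ.+ convolve (λ i k → convolve (λ a b → ψ (suc a) b k) i) n
    ≡⟨ cong (convolve (ψ 0) (suc n) ℤ.+_) (convolve-assoc (ψ ∘ suc) n) ⟩
  convolve (ψ 0) (suc n) ℤ.+ convolve (λ a i → convolve (ψ (suc a)) i) n ∎
  where open ≡-Reasoning

convolve-upTo : ∀ φ n → sumℤ (map (λ i → φ i (n ℕ.∸ i)) (upTo (suc n))) ≡ convolve φ n
convolve-upTo φ n = trans (cong sumℤ (map-upTo (λ i → φ i (n ℕ.∸ i)) (suc n))) (go φ n)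
  where
  go : ∀ φ n → sumℤ (applyUpTo (λ i → φ i (n ℕ.∸ i)) (suc n)) ≡ convolve φ n
  go φ zero    = ℤ.+-identityʳ _
  go φ (suc n) = cong (φ 0 (suc n) ℤ.+_) (go (φ ∘ suc) n)

-- The Cauchy product by recursion on the monomial, which reduces every ring law to
-- a law of the one-variable convolution.

infixl 7 _⊛_

_⊛_ : (Monomial → ℤ) → (Monomial → ℤ) → Monomial → ℤ
(F ⊛ H) []      = F [] ℤ.* H []
(F ⊛ H) (e ∷ m) = convolve (λ i j → (F ∘ (i ∷_) ⊛ H ∘ (j ∷_)) m) e

cauchy-⊛ : ∀ F H m → cauchy F H m ≡ (F ⊛ H) m
cauchy-⊛ F H []      = ℤ.+-identityʳ _
cauchy-⊛ F H (e ∷ m) = begin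
  cauchy F H (e ∷ m)
    ≡⟨ sum-cartesianProductWith _ _ (upTo (suc e)) (factorisations m) ⟩
  sumℤ (map (λ i → cauchy (F ∘ (i ∷_)) (H ∘ (e ℕ.∸ i ∷_)) m) (upTo (suc e)))
    ≡⟨ convolve-upTo (λ i j → cauchy (F ∘ (i ∷_)) (H ∘ (j ∷_)) m) e ⟩
  convolve (λ i j → cauchy (F ∘ (i ∷_)) (H ∘ (j ∷_)) m) e
    ≡⟨ convolve-cong e (λ _ _ → cauchy-⊛ _ _ m) ⟩
  (F ⊛ H) (e ∷ m) ∎
  where open ≡-Reasoning

-- Divisibility, with a padded to exactly the length of m.

infix 4 _≤ₘ_

_≤ₘ_ : Monomial → Monomial → Set
_≤ₘ_ = Pointwise ℕ._≤_

-- A coefficient of a product depends only on values at divisors of `m`. This locality later allows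
-- a factor to be replaced by a truncated sum or by a series that agrees with it in low degrees.
⊛-cong : ∀ {F F′ H H′} m →
         (∀ {a} → a ≤ₘ m → F a ≡ F′ a) → (∀ {a} → a ≤ₘ m → H a ≡ H′ a) →
         (F ⊛ H) m ≡ (F′ ⊛ H′) m
⊛-cong []      p q = cong₂ ℤ._*_ (p []) (q [])
⊛-cong (e ∷ m) p q =
  convolve-cong e λ i≤e j≤e → ⊛-cong m (p ∘ (i≤e ∷_)) (q ∘ (j≤e ∷_))

⊛-comm : ∀ F H m → (F ⊛ H) m ≡ (H ⊛ F) m
⊛-comm F H []      = ℤ.*-comm (F []) (H [])
⊛-comm F H (e ∷ m) =
  trans (convolve-flip _ e) (convolve-cong e λ _ _ → ⊛-comm _ _ m)

⊛-distribˡ : ∀ F H K m → (F ⊛ (λ a → H a ℤ.+ K a)) m ≡ (F ⊛ H) m ℤ.+ (F ⊛ K) m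
⊛-distribˡ F H K []      = ℤ.*-distribˡ-+ (F []) (H []) (K [])
⊛-distribˡ F H K (e ∷ m) =
  trans (convolve-cong e λ _ _ → ⊛-distribˡ _ _ _ m) (convolve-+ _ _ e)

⊛-zeroˡ : ∀ {F} H m → (∀ a → F a ≡ 0ℤ) → (F ⊛ H) m ≡ 0ℤ
⊛-zeroˡ H []      F≡0 = cong (ℤ._* H []) (F≡0 [])
⊛-zeroˡ H (e ∷ m) F≡0 = convolve-0 e λ i j → ⊛-zeroˡ _ m (F≡0 ∘ (i ∷_))

⊛-convolveʳ : ∀ F (Φ : ℕ → ℕ → Monomial → ℤ) n m →
              (F ⊛ (λ a → convolve (λ i j → Φ i j a) n)) m ≡
              convolve (λ i j → (F ⊛ Φ i j) m) n
⊛-convolveʳ F Φ zero    m = refl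
⊛-convolveʳ F Φ (suc n) m =
  trans (⊛-distribˡ F (Φ 0 (suc n)) _ m)
        (cong ((F ⊛ Φ 0 (suc n)) m ℤ.+_) (⊛-convolveʳ F (Φ ∘ suc) n m))

⊛-convolveˡ : ∀ (Φ : ℕ → ℕ → Monomial → ℤ) H n m →
              ((λ a → convolve (λ i j → Φ i j a) n) ⊛ H) m ≡
              convolve (λ i j → (Φ i j ⊛ H) m) n
⊛-convolveˡ Φ H n m = begin
  ((λ a → convolve (λ i j → Φ i j a) n) ⊛ H) m  ≡⟨ ⊛-comm _ H m ⟩
  (H ⊛ (λ a → convolve (λ i j → Φ i j a) n)) m  ≡⟨ ⊛-convolveʳ H Φ n m ⟩
  convolve (λ i j → (H ⊛ Φ i j) m) n            ≡⟨ convolve-cong n (λ _ _ → ⊛-comm H _ m) ⟩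
  convolve (λ i j → (Φ i j ⊛ H) m) n            ∎
  where open ≡-Reasoning

-- Fixing the first exponent of a product gives a convolution of products. Pulled out by
-- bilinearity, it leaves `convolve-assoc` for the first exponent and induction for the remaining
-- ones.
⊛-assoc : ∀ F H K m → ((F ⊛ H) ⊛ K) m ≡ (F ⊛ (H ⊛ K)) m
⊛-assoc F H K []      = ℤ.*-assoc (F []) (H []) (K [])
⊛-assoc F H K (e ∷ m) = begin
  convolve (λ i k → ((λ a → convolve (λ p q → (F ∘ (p ∷_) ⊛ H ∘ (q ∷_)) a) i) ⊛ K ∘ (k ∷_)) m) e
    ≡⟨ convolve-cong e (λ {i} _ _ → ⊛-convolveˡ _ _ i m) ⟩
  convolve (λ i k → convolve (λ p q → (F ∘ (p ∷_) ⊛ H ∘ (q ∷_) ⊛ K ∘ (k ∷_)) m) i) e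
    ≡⟨ convolve-assoc (λ p q k → (F ∘ (p ∷_) ⊛ H ∘ (q ∷_) ⊛ K ∘ (k ∷_)) m) e ⟩
  convolve (λ p i → convolve (λ q k → (F ∘ (p ∷_) ⊛ H ∘ (q ∷_) ⊛ K ∘ (k ∷_)) m) i) e
    ≡⟨ convolve-cong e (λ {_} {i} _ _ → convolve-cong i λ _ _ → ⊛-assoc _ _ _ m) ⟩
  convolve (λ p i → convolve (λ q k → (F ∘ (p ∷_) ⊛ (H ∘ (q ∷_) ⊛ K ∘ (k ∷_))) m) i) e
    ≡⟨ convolve-cong e (λ {p} {i} _ _ → ⊛-convolveʳ (F ∘ (p ∷_)) _ i m) ⟨
  convolve (λ p i → (F ∘ (p ∷_) ⊛ (λ a → convolve (λ q k → (H ∘ (q ∷_) ⊛ K ∘ (k ∷_)) a) i)) m) e ∎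
  where open ≡-Reasoning

-- Multiplication by 1 and by a variable

coeff-monomial-⇔ : ∀ {a b c d} → (a ≈ₘ b → c ≈ₘ d) → (c ≈ₘ d → a ≈ₘ b) →
                   coeff (monomial a) b ≡ coeff (monomial c) d
coeff-monomial-⇔ {a} {b} {c} {d} f g =
  cong (if_then 1ℤ else 0ℤ) (does-⇔ (mk⇔ f g) (a ≈ₘ? b) (c ≈ₘ? d))

coeff-monomial-≉ : ∀ a b → ¬ a ≈ₘ b → coeff (monomial a) b ≡ 0ℤ
coeff-monomial-≉ a b a≉b = cong (if_then 1ℤ else 0ℤ) (dec-false (a ≈ₘ? b) a≉b)

∷-≉ : ∀ {x y a b} → x ≢ y → ¬ x ∷ a ≈ₘ y ∷ b
∷-≉ x≢y p = x≢y (at p 0)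

var-≉[] : ∀ k → ¬ var k ≈ₘ []
var-≉[] zero    p = ℕ.1+n≢0 (at p 0)
var-≉[] (suc k) p = var-≉[] k (≈ₘ-sym ([]-tail-≈ (≈ₘ-sym p)))

⊛-identityˡ : ∀ F m → (coeff 1# ⊛ F) m ≡ F m
⊛-identityˡ F []      = ℤ.*-identityˡ _
⊛-identityˡ F (e ∷ m) = begin
  convolve (λ i j → (coeff 1# ∘ (i ∷_) ⊛ F ∘ (j ∷_)) m) e
    ≡⟨ convolve-head e (λ i j → ⊛-zeroˡ _ m λ a →
         coeff-monomial-≉ [] (suc i ∷ a) λ p → ℕ.0≢1+n (at p 0)) ⟩
  (coeff 1# ∘ (0 ∷_) ⊛ F ∘ (e ∷_)) m
    ≡⟨ ⊛-cong m (λ {a} _ → coeff-monomial-⇔ {[]} {0 ∷ a} []-tail-≈ 0∷-≈) (λ _ → refl) ⟩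
  (coeff 1# ⊛ F ∘ (e ∷_)) m
    ≡⟨ ⊛-identityˡ (F ∘ (e ∷_)) m ⟩
  F (e ∷ m) ∎
  where open ≡-Reasoning

divideByVar : ℕ → Monomial → Maybe Monomial
divideByVar k       []          = nothing
divideByVar zero    (zero ∷ m)  = nothing
divideByVar zero    (suc e ∷ m) = just (e ∷ m)
divideByVar (suc k) (e ∷ m)     = Maybe.map (e ∷_) (divideByVar k m)

-- At most one factorisation of `m` has the variable as its left part, so multiplication by it
-- shifts coefficients; `0ℤ` covers monomials that it does not divide. All later degree arguments go
-- through this shift.
t₊-⊛ : ∀ k F m → (coeff (t₊ k) ⊛ F) m ≡ maybe′ F 0ℤ (divideByVar k m)
t₊-⊛ k       F []          = cong (ℤ._* F []) (coeff-monomial-≉ (var k) [] (var-≉[] k))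
t₊-⊛ zero    F (zero ∷ m)  = ⊛-zeroˡ _ m λ a → coeff-monomial-≉ (var 0) (0 ∷ a) (∷-≉ λ ())
t₊-⊛ zero    F (suc e ∷ m) = begin
  term 0 (suc e) ℤ.+ convolve (term ∘ suc) e
    ≡⟨ cong₂ ℤ._+_
         (⊛-zeroˡ _ m λ a → coeff-monomial-≉ (var 0) (0 ∷ a) (∷-≉ λ ()))
         (convolve-head e λ i j → ⊛-zeroˡ _ m λ a →
           coeff-monomial-≉ (var 0) (suc (suc i) ∷ a) (∷-≉ λ ())) ⟩
  0ℤ ℤ.+ term 1 e
    ≡⟨ ℤ.+-identityˡ _ ⟩
  term 1 e
    ≡⟨ ⊛-cong m (λ {a} _ → coeff-monomial-⇔ {var 0} {1 ∷ a} tail-≈ (∷-cong refl)) (λ _ → refl) ⟩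
  (coeff 1# ⊛ F ∘ (e ∷_)) m
    ≡⟨ ⊛-identityˡ (F ∘ (e ∷_)) m ⟩
  F (e ∷ m) ∎
  where
  open ≡-Reasoning
  term : ℕ → ℕ → ℤ
  term i j = (coeff (t₊ 0) ∘ (i ∷_) ⊛ F ∘ (j ∷_)) m
t₊-⊛ (suc k) F (e ∷ m) = begin
  convolve (λ i j → (coeff (t₊ (suc k)) ∘ (i ∷_) ⊛ F ∘ (j ∷_)) m) e
    ≡⟨ convolve-head e (λ i j → ⊛-zeroˡ _ m λ a →
         coeff-monomial-≉ (var (suc k)) (suc i ∷ a) (∷-≉ λ ())) ⟩
  (coeff (t₊ (suc k)) ∘ (0 ∷_) ⊛ F ∘ (e ∷_)) m
    ≡⟨ ⊛-cong m (λ {a} _ → coeff-monomial-⇔ {var (suc k)} {0 ∷ a} tail-≈ (∷-cong refl)) (λ _ → refl) ⟩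
  (coeff (t₊ k) ⊛ F ∘ (e ∷_)) m
    ≡⟨ t₊-⊛ k (F ∘ (e ∷_)) m ⟩
  maybe′ (F ∘ (e ∷_)) 0ℤ (divideByVar k m)
    ≡⟨ maybe′-map F 0ℤ (e ∷_) (divideByVar k m) ⟨
  maybe′ F 0ℤ (Maybe.map (e ∷_) (divideByVar k m)) ∎
  where open ≡-Reasoning

-- The ring of power series

-_ : PowerSeries → PowerSeries
(- F) .coeff m      = ℤ.- coeff F m
(- F) .coeff-cong p = cong ℤ.-_ (coeff-cong F p)

*-cong-at : ∀ F F′ H H′ m → (∀ {a} → a ≤ₘ m → coeff F a ≡ coeff F′ a) →
            (∀ {a} → a ≤ₘ m → coeff H a ≡ coeff H′ a) →
            coeff (F * H) m ≡ coeff (F′ * H′) m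
*-cong-at F F′ H H′ m p q =
  trans (cauchy-⊛ (coeff F) (coeff H) m)
        (trans (⊛-cong m p q) (sym (cauchy-⊛ (coeff F′) (coeff H′) m)))

*-comm : ∀ F H → F * H ≈ H * F
*-comm F H m =
  trans (cauchy-⊛ (coeff F) (coeff H) m)
        (trans (⊛-comm (coeff F) (coeff H) m) (sym (cauchy-⊛ (coeff H) (coeff F) m)))

*-assoc : ∀ F H K → F * H * K ≈ F * (H * K)
*-assoc F H K m = begin
  coeff (F * H * K) m                    ≡⟨ cauchy-⊛ (coeff (F * H)) (coeff K) m ⟩
  (coeff (F * H) ⊛ coeff K) m            ≡⟨ ⊛-cong m (λ {a} _ → cauchy-⊛ (coeff F) (coeff H) a) (λ _ → refl) ⟩
  (coeff F ⊛ coeff H ⊛ coeff K) m        ≡⟨ ⊛-assoc (coeff F) (coeff H) (coeff K) m ⟩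
  (coeff F ⊛ (coeff H ⊛ coeff K)) m      ≡⟨ ⊛-cong m (λ _ → refl) (λ {a} _ → cauchy-⊛ (coeff H) (coeff K) a) ⟨
  (coeff F ⊛ coeff (H * K)) m            ≡⟨ cauchy-⊛ (coeff F) (coeff (H * K)) m ⟨
  coeff (F * (H * K)) m                  ∎
  where open ≡-Reasoning

*-identityˡ : ∀ F → 1# * F ≈ F
*-identityˡ F m = trans (cauchy-⊛ (coeff 1#) (coeff F) m) (⊛-identityˡ (coeff F) m)

*-distribˡ-+ : ∀ F H K → F * (H + K) ≈ F * H + F * K
*-distribˡ-+ F H K m = begin
  coeff (F * (H + K)) m                              ≡⟨ cauchy-⊛ (coeff F) (coeff (H + K)) m ⟩
  (coeff F ⊛ coeff (H + K)) m                        ≡⟨ ⊛-distribˡ (coeff F) (coeff H) (coeff K) m ⟩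
  (coeff F ⊛ coeff H) m ℤ.+ (coeff F ⊛ coeff K) m    ≡⟨ cong₂ ℤ._+_ (cauchy-⊛ (coeff F) (coeff H) m) (cauchy-⊛ (coeff F) (coeff K) m) ⟨
  coeff (F * H + F * K) m                            ∎
  where open ≡-Reasoning

powerSeriesRing : CommutativeRing 0ℓ 0ℓ
powerSeriesRing = record
  { Carrier = PowerSeries
  ; _≈_ = _≈_
  ; _+_ = _+_
  ; _*_ = _*_
  ; -_  = -_
  ; 0#  = 0#
  ; 1#  = 1#
  ; isCommutativeRing = record
    { isRing = record
      { +-isAbelianGroup = record
        { isGroup = record
          { isMonoid = record
            { isSemigroup = record
              { isMagma = record
                { isEquivalence = record
                  { refl  = λ _ → refl
                  ; sym   = λ p m → sym (p m)
                  ; trans = λ p q m → trans (p m) (q m)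
                  }
                ; ∙-cong = λ p q m → cong₂ ℤ._+_ (p m) (q m)
                }
              ; assoc = λ F H K m → ℤ.+-assoc (coeff F m) (coeff H m) (coeff K m)
              }
            ; identity = (λ F m → ℤ.+-identityˡ (coeff F m)) , (λ F m → ℤ.+-identityʳ (coeff F m))
            }
          ; inverse = (λ F m → ℤ.+-inverseˡ (coeff F m)) , (λ F m → ℤ.+-inverseʳ (coeff F m))
          ; ⁻¹-cong = λ p m → cong ℤ.-_ (p m)
          }
        ; comm = λ F H m → ℤ.+-comm (coeff F m) (coeff H m)
        }
      ; *-cong = λ {F} {F′} {H} {H′} p q m → *-cong-at F F′ H H′ m (λ {a} _ → p a) (λ {a} _ → q a)
      ; *-assoc = *-assoc
      ; *-identity = *-identityˡ , λ F m → trans (*-comm F 1# m) (*-identityˡ F m)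
      ; distrib = *-distribˡ-+ , λ K F H m →
          trans (*-comm (F + H) K m)
                (trans (*-distribˡ-+ K F H m) (cong₂ ℤ._+_ (*-comm K F m) (*-comm K H m)))
      }
    ; *-comm = *-comm
    }
  }

-- Infinite sums

open RingSums powerSeriesRing

coeff-t₊-* : ∀ k F m → coeff (t₊ k * F) m ≡ maybe′ (coeff F) 0ℤ (divideByVar k m)
coeff-t₊-* k F m = trans (cauchy-⊛ (coeff (t₊ k)) (coeff F) m) (t₊-⊛ k (coeff F) m)

divideByVar-≥length : ∀ {k} m → length m ℕ.≤ k → divideByVar k m ≡ nothing
divideByVar-≥length []      _         = refl
divideByVar-≥length (e ∷ m) (s≤s m≤k) = cong (Maybe.map (e ∷_)) (divideByVar-≥length m m≤k)

degree-divideByVar : ∀ k m {m′} → divideByVar k m ≡ just m′ → sum m ≡ suc (sum m′)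
degree-divideByVar zero    (suc e ∷ m) refl = refl
degree-divideByVar (suc k) (e ∷ m)     eq   with divideByVar k m in eq′
degree-divideByVar (suc k) (e ∷ m)     refl | just m′ =
  trans (cong (e ℕ.+_) (degree-divideByVar k m eq′)) (ℕ.+-suc e (sum m′))

degree-divideByVar-< : ∀ {d} k m {m′} → divideByVar k m ≡ just m′ →
                       sum m ℕ.< suc d → sum m′ ℕ.< d
degree-divideByVar-< {d} k m eq m<1+d =
  ℕ.≤-pred (subst (ℕ._< suc d) (degree-divideByVar k m eq) m<1+d)

t₊-*-≥length : ∀ {k} F m → length m ℕ.≤ k → coeff (t₊ k * F) m ≡ 0ℤ
t₊-*-≥length {k} F m m≤k =
  trans (coeff-t₊-* k F m) (cong (maybe′ (coeff F) 0ℤ) (divideByVar-≥length m m≤k))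

coeff-sumBelow : ∀ f n m →
                 coeff (sumBelow f n) m ≡ sumℤ (map (λ k → coeff (f k) m) (upTo n))
coeff-sumBelow f zero    m = refl
coeff-sumBelow f (suc n) m = begin
  coeff (sumBelow f n) m ℤ.+ coeff (f n) m
    ≡⟨ cong₂ ℤ._+_ (coeff-sumBelow f n m) (sym (ℤ.+-identityʳ (coeff (f n) m))) ⟩
  sumℤ (map term (upTo n)) ℤ.+ sumℤ (map term (n ∷ []))
    ≡⟨ sum-++ (map term (upTo n)) (map term (n ∷ [])) ⟨
  sumℤ (map term (upTo n) ++ map term (n ∷ []))
    ≡⟨ cong sumℤ (map-++ term (upTo n) (n ∷ [])) ⟨
  sumℤ (map term (upTo n ∷ʳ n))
    ≡⟨ cong (sumℤ ∘ map term) (upTo-∷ʳ n) ⟩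
  sumℤ (map term (upTo (suc n))) ∎
  where
  open ≡-Reasoning
  term : ℕ → ℤ
  term k = coeff (f k) m

varSumBelow : (ℕ → PowerSeries) → ℕ → PowerSeries
varSumBelow F = sumBelow (λ k → t₊ k * F k)

-- Equal monomials may carry different numbers of trailing zeros. Stability lets the bounds of both
-- be raised to a common one, which makes `varSum` respect `_≈ₘ_`.
varSumBelow-stable : ∀ F {n} m → length m ℕ.≤ n →
                     coeff (varSumBelow F n) m ≡ coeff (varSumBelow F (length m)) m
varSumBelow-stable F m m≤n = go (ℕ.≤⇒≤′ m≤n)
  where
  go : ∀ {n} → length m ℕ.≤′ n → coeff (varSumBelow F n) m ≡ coeff (varSumBelow F (length m)) m
  go (ℕ.≤′-reflexive refl) = refl
  go (ℕ.≤′-step {n} m≤′n)  =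
    trans (cong₂ ℤ._+_ (go m≤′n) (t₊-*-≥length (F n) m (ℕ.≤′⇒≤ m≤′n))) (ℤ.+-identityʳ _)

-- Σ_{k ≥ 0} t₊ k · F k; a monomial of length l involves only t₊ 0, …, t₊ (l − 1).

varSum : (ℕ → PowerSeries) → PowerSeries
varSum F .coeff m = coeff (varSumBelow F (length m)) m
varSum F .coeff-cong {a} {b} a≈b = begin
  coeff (varSumBelow F (length a)) a  ≡⟨ varSumBelow-stable F a (ℕ.m≤m⊔n (length a) (length b)) ⟨
  coeff (varSumBelow F l) a           ≡⟨ coeff-cong (varSumBelow F l) a≈b ⟩
  coeff (varSumBelow F l) b           ≡⟨ varSumBelow-stable F b (ℕ.m≤n⊔m (length a) (length b)) ⟩
  coeff (varSumBelow F (length b)) b  ∎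
  where
  open ≡-Reasoning
  l = length a ℕ.⊔ length b

module PS = CommutativeRing powerSeriesRing

varSum-cong : ∀ F H → (∀ k → F k ≈ H k) → varSum F ≈ varSum H
varSum-cong F H F≈H m =
  sumBelow-cong {λ k → t₊ k * F k} {λ k → t₊ k * H k} (length m)
    (λ k → PS.*-congˡ {t₊ k} {F k} {H k} (F≈H k)) m

varSum-+ : ∀ F H → varSum (λ k → F k + H k) ≈ varSum F + varSum H
varSum-+ F H m =
  trans (sumBelow-cong {λ k → t₊ k * (F k + H k)} {λ k → t₊ k * F k + t₊ k * H k} (length m)
          (λ k → *-distribˡ-+ (t₊ k) (F k) (H k)) m)
        (sumBelow-+ (λ k → t₊ k * F k) (λ k → t₊ k * H k) (length m) m)

varSum-*ʳ : ∀ F H → varSum F * H ≈ varSum (λ k → F k * H)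
varSum-*ʳ F H m = begin
  coeff (varSum F * H) m
    -- The divisors that occur are padded to the length of `m`, so one truncation serves for all of
    -- them.
    ≡⟨ *-cong-at (varSum F) (varSumBelow F (length m)) H H m
         (λ {a} a≤m → cong (λ l → coeff (varSumBelow F l) a) (Pointwise-length a≤m)) (λ _ → refl) ⟩
  coeff (varSumBelow F (length m) * H) m
    ≡⟨ sumBelow-*ʳ (λ k → t₊ k * F k) H (length m) m ⟩
  coeff (sumBelow (λ k → t₊ k * F k * H) (length m)) m
    ≡⟨ sumBelow-cong {λ k → t₊ k * F k * H} {λ k → t₊ k * (F k * H)} (length m)
         (λ k → *-assoc (t₊ k) (F k) H) m ⟩
  coeff (varSum (λ k → F k * H)) m ∎
  where open ≡-Reasoning

-- Fixed points of contractive operators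

infix 4 _≈[_]_

-- Equality modulo monomials of degree at least d.

_≈[_]_ : PowerSeries → ℕ → PowerSeries → Set
F ≈[ d ] H = ∀ m → sum m ℕ.< d → coeff F m ≡ coeff H m

degree-mono : ∀ {a m} → a ≤ₘ m → sum a ℕ.≤ sum m
degree-mono []          = z≤n
degree-mono (i≤e ∷ a≤m) = ℕ.+-mono-≤ i≤e (degree-mono a≤m)

degree-cong : ∀ a b → a ≈ₘ b → sum a ≡ sum b
degree-cong []      []      p = refl
degree-cong []      (y ∷ b) p = cong₂ ℕ._+_ (at p 0) (degree-cong [] b ([]-tail-≈ p))
degree-cong (x ∷ a) []      p =
  cong₂ ℕ._+_ (at p 0) (degree-cong a [] (≈ₘ-sym ([]-tail-≈ (≈ₘ-sym p))))
degree-cong (x ∷ a) (y ∷ b) p = cong₂ ℕ._+_ (at p 0) (degree-cong a b (tail-≈ p))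

*-cong-≈[] : ∀ {d} F F′ H H′ → F ≈[ d ] F′ → H ≈[ d ] H′ → F * H ≈[ d ] F′ * H′
*-cong-≈[] F F′ H H′ p q m m<d = *-cong-at F F′ H H′ m
  (λ {a} a≤m → p a (ℕ.≤-<-trans (degree-mono a≤m) m<d))
  (λ {a} a≤m → q a (ℕ.≤-<-trans (degree-mono a≤m) m<d))

^-cong-≈[] : ∀ {d} F F′ n → F ≈[ d ] F′ → F ^ n ≈[ d ] F′ ^ n
^-cong-≈[] F F′ zero    p _ _ = refl
^-cong-≈[] F F′ (suc n) p     =
  *-cong-≈[] F F′ (F ^ n) (F′ ^ n) p (^-cong-≈[] F F′ n p)

varSum-cong-≈[] : ∀ {d} F F′ → (∀ k → F k ≈[ d ] F′ k) → varSum F ≈[ suc d ] varSum F′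
varSum-cong-≈[] {d} F F′ p m m<1+d = go (length m)
  where
  quotient : ∀ k q → divideByVar k m ≡ q →
             maybe′ (coeff (F k)) 0ℤ q ≡ maybe′ (coeff (F′ k)) 0ℤ q
  quotient k nothing   _  = refl
  quotient k (just m′) eq = p k m′ (degree-divideByVar-< k m eq m<1+d)

  go : ∀ n → coeff (varSumBelow F n) m ≡ coeff (varSumBelow F′ n) m
  go zero    = refl
  go (suc n) = cong₂ ℤ._+_ (go n)
    (trans (coeff-t₊-* n (F n) m)
           (trans (quotient n (divideByVar n m) refl) (sym (coeff-t₊-* n (F′ n) m))))

Contractive : (PowerSeries → PowerSeries) → Set
Contractive Φ = ∀ d F H → F ≈[ d ] H → Φ F ≈[ suc d ] Φ H

-- The Banach fixed-point argument for the degree filtration: each iteration makes one more degree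
-- final.
module FixedPoint (Φ : PowerSeries → PowerSeries) (contractive : Contractive Φ) where

  approximant : ℕ → PowerSeries
  approximant zero    = 0#
  approximant (suc n) = Φ (approximant n)

  approximant-agree : ∀ {n n′} → n ℕ.≤ n′ → approximant n ≈[ n ] approximant n′
  approximant-agree z≤n _ ()
  approximant-agree {suc n} {suc n′} (s≤s n≤n′) =
    contractive n (approximant n) (approximant n′) (approximant-agree n≤n′)

  fixedPoint : PowerSeries
  -- `approximant n` is final strictly below degree `n`, hence the successor.
  fixedPoint .coeff m = coeff (approximant (suc (sum m))) m
  fixedPoint .coeff-cong {a} {b} a≈b =
    trans (cong (λ d → coeff (approximant (suc d)) a) (degree-cong a b a≈b))
          (coeff-cong (approximant (suc (sum b))) a≈b)

  fixedPoint-≈ : fixedPoint ≈ Φ fixedPoint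
  fixedPoint-≈ m =
    -- At `m` the left side is by definition the coefficient of `Φ (approximant (sum m))`, so
    -- agreement of the arguments below degree `sum m` is enough.
    sym (contractive (sum m) fixedPoint (approximant (sum m))
          (λ a a<m → approximant-agree a<m a ℕ.≤-refl) m ℕ.≤-refl)

  fixedPoint-unique : ∀ {F H} → F ≈ Φ F → H ≈ Φ H → F ≈ H
  fixedPoint-unique {F} {H} F≈ΦF H≈ΦH m = go (suc (sum m)) m ℕ.≤-refl
    where
    go : ∀ d → F ≈[ d ] H
    go (suc d) a a<1+d =
      trans (F≈ΦF a) (trans (contractive d F H (go d) a a<1+d) (sym (H≈ΦH a)))

-- Formal sums

sum-filter-nonzero : ∀ {I : Set} (f : I → ℤ) is →
                     sumℤ (map f (filter (λ i → ¬? (f i ℤ.≟ 0ℤ)) is)) ≡ sumℤ (map f is)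
sum-filter-nonzero f []       = refl
sum-filter-nonzero f (i ∷ is) with f i ℤ.≟ 0ℤ
... | no  _  = cong (f i ℤ.+_) (sum-filter-nonzero f is)
... | yes eq = trans (sum-filter-nonzero f is)
                     (sym (trans (cong (ℤ._+ sumℤ (map f is)) eq) (ℤ.+-identityˡ _)))

-- The two index lists can differ only in order and in terms that vanish. Once these are filtered
-- out, both list the contributing indices exactly once, so they are permutations of each other.
HasSum-unique : ∀ {I : Set} {A : Pred I 0ℓ} {f F H} → HasSum A f F → HasSum A f H → F ≈ H
HasSum-unique {f = f} {F} {H} sumF sumH m with sumF m | sumH m
... | is , is! , Ais , is-complete , F≡ | js , js! , Ajs , js-complete , H≡ = begin
  coeff F m                                ≡⟨ F≡ ⟩
  sumℤ (map term is)                       ≡⟨ sum-filter-nonzero term is ⟨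
  sumℤ (map term (filter nonzero? is))     ≡⟨ foldr-commMonoid (setoid ℤ) ℤ.+-0-isCommutativeMonoid
                                                (↭⇒↭ₛ (map⁺ term same-support)) ⟩
  sumℤ (map term (filter nonzero? js))     ≡⟨ sum-filter-nonzero term js ⟩
  sumℤ (map term js)                       ≡⟨ H≡ ⟨
  coeff H m                                ∎
  where
  open ≡-Reasoning
  term = λ i → coeff (f i) m
  nonzero? = λ i → ¬? (term i ℤ.≟ 0ℤ)
  same-support : filter nonzero? is ↭ filter nonzero? js
  same-support = ∼bag⇒↭ (unique∧set⇒bag (Unique.filter⁺ nonzero? is!) (Unique.filter⁺ nonzero? js!)
    (mk⇔ (λ i∈ → let i∈is , ne = ∈-filter⁻ nonzero? i∈
                 in ∈-filter⁺ nonzero? (js-complete _ (All.lookup Ais i∈is) ne) ne)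
         (λ i∈ → let i∈js , ne = ∈-filter⁻ nonzero? i∈
                 in ∈-filter⁺ nonzero? (is-complete _ (All.lookup Ajs i∈js) ne) ne)))

varSum-hasSum : ∀ F → HasSum U (λ k → t₊ k * F k) (varSum F)
varSum-hasSum F m =
  upTo (length m) , Unique.upTo⁺ (length m) , All.universal _ _ ,
  (λ k _ ne → ∈-upTo⁺ (ℕ.≰⇒> (ne ∘ t₊-*-≥length (F k) m))) ,
  coeff-sumBelow _ (length m) m

HasSum-cong : ∀ {I : Set} {A : Pred I 0ℓ} {f g F} →
              (∀ i → f i ≈ g i) → HasSum A f F → HasSum A g F
HasSum-cong f≈g hasSum m with hasSum m
... | is , is! , Ais , complete , F≡ =
  is , is! , Ais ,
  (λ i Ai ne → complete i Ai (ne ∘ trans (sym (f≈g i m)))) ,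
  trans F≡ (cong sumℤ (map-cong (λ i → f≈g i m) is))

S₁-varSum : S₁ ≈ varSum (const 1#)
S₁-varSum = HasSum-unique {f = t₊} {S₁} {varSum (const 1#)} S₁-hasSum
  (HasSum-cong {f = λ k → t₊ k * 1#} {t₊} {varSum (const 1#)}
    (λ k → PS.*-identityʳ (t₊ k)) (varSum-hasSum (const 1#)))

-- The two fixed-point equations

S-operator : PowerSeries → PowerSeries
S-operator F = 1# + varSum (λ k → F ^ suc k)

1+-cong-≈[] : ∀ {d} F H → F ≈[ d ] H → 1# + F ≈[ d ] 1# + H
1+-cong-≈[] F H p m m<d = cong (coeff 1# m ℤ.+_) (p m m<d)

S-operator-contractive : Contractive S-operator
S-operator-contractive d F H p =
  1+-cong-≈[] (varSum (λ k → F ^ suc k)) (varSum (λ k → H ^ suc k))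
    (varSum-cong-≈[] (λ k → F ^ suc k) (λ k → H ^ suc k) λ k → ^-cong-≈[] F H (suc k) p)

module FixedS = FixedPoint S-operator S-operator-contractive

S-equation⇒fixed : ∀ {S} → SatisfiesSEquation S → S ≈ S-operator S
S-equation⇒fixed {S} (F , hasSum , S≈1+F) m = trans (S≈1+F m) (cong (coeff 1# m ℤ.+_)
  (HasSum-unique {f = λ k → t₊ k * S ^ suc k} {F} {varSum (λ k → S ^ suc k)}
    hasSum (varSum-hasSum (λ k → S ^ suc k)) m))

fixed⇒S-equation : ∀ {S} → S ≈ S-operator S → SatisfiesSEquation S
fixed⇒S-equation {S} S≈ = varSum (λ k → S ^ suc k) , varSum-hasSum _ , S≈

open GeodeAlgebra powerSeriesRing

N-operator : PowerSeries → PowerSeries → PowerSeries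
N-operator S F = 1# + varSum (λ k → F * geometric S (suc k))

N-operator-contractive : ∀ S → Contractive (N-operator S)
N-operator-contractive S d F H p =
  1+-cong-≈[] (varSum (λ k → F * g k)) (varSum (λ k → H * g k))
    (varSum-cong-≈[] (λ k → F * g k) (λ k → H * g k) λ k →
      *-cong-≈[] F H (g k) (g k) p λ _ _ → refl)
  where
  g : ℕ → PowerSeries
  g k = geometric S (suc k)

-- Enumeration of paths

-- Nonnegative paths are those that stay positive from height 1.  No path is positive
-- from height 0, so the down step needs no case distinction.

data Positive : ℕ → Pred Path 0ℓ where
  []     : ∀ {h} → Positive (suc h) []
  down∷_ : ∀ {h P} → Positive h P → Positive (suc h) (down ∷ P)
  up∷_   : ∀ {h k P} → Positive (suc h ℕ.+ k) P → Positive (suc h) (up k ∷ P)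

Positive⇒1≤ : ∀ {h P} → Positive h P → ∀ i → 1ℤ ℤ.≤ ℤ.fromℕ h ℤ.+ sumℤ (map ⟦_⟧ (take i P))
Positive⇒1≤ {suc h} p zero = ℤ.+≤+ (s≤s z≤n)
Positive⇒1≤ [] (suc i) = ℤ.+≤+ (s≤s z≤n)
Positive⇒1≤ {suc h} {down ∷ P} (down∷ p) (suc i) =
  subst (1ℤ ℤ.≤_) (ℤ.+-assoc (ℤ.fromℕ (suc h)) -1ℤ (sumℤ (map ⟦_⟧ (take i P)))) (Positive⇒1≤ p i)
Positive⇒1≤ {suc h} {up k ∷ P} (up∷ p) (suc i) =
  subst (1ℤ ℤ.≤_) (ℤ.+-assoc (ℤ.fromℕ (suc h)) (ℤ.fromℕ k) (sumℤ (map ⟦_⟧ (take i P)))) (Positive⇒1≤ p i)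

1≤⇒Positive : ∀ h P → (∀ i → 1ℤ ℤ.≤ ℤ.fromℕ h ℤ.+ sumℤ (map ⟦_⟧ (take i P))) → Positive h P
1≤⇒Positive zero    P          p with ℤ.+≤+ () ← p 0
1≤⇒Positive (suc h) []         p = []
1≤⇒Positive (suc h) (down ∷ P) p =
  down∷ 1≤⇒Positive h P λ i →
    subst (1ℤ ℤ.≤_) (sym (ℤ.+-assoc (ℤ.fromℕ (suc h)) -1ℤ (sumℤ (map ⟦_⟧ (take i P))))) (p (suc i))
1≤⇒Positive (suc h) (up k ∷ P) p =
  up∷ 1≤⇒Positive (suc h ℕ.+ k) P λ i →
    subst (1ℤ ℤ.≤_) (sym (ℤ.+-assoc (ℤ.fromℕ (suc h)) (ℤ.fromℕ k) (sumℤ (map ⟦_⟧ (take i P))))) (p (suc i))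

Positive-1⇒Nonnegative : ∀ {P} → Positive 1 P → Nonnegative P
Positive-1⇒Nonnegative p i = subst (0ℤ ℤ.≤_) (ℤ.pred-suc _) (ℤ.pred-mono (Positive⇒1≤ p i))

Nonnegative⇒Positive-1 : ∀ {P} → Nonnegative P → Positive 1 P
Nonnegative⇒Positive-1 {P} p = 1≤⇒Positive 1 P λ i → ℤ.+-monoʳ-≤ 1ℤ (p i)

-- Contains every path that is positive from height h and has weight m, provided that the
-- degree of m is below the fuel d; paths of other weights may occur too.

mutual
  paths : ℕ → ℕ → Monomial → List Path
  paths zero    h       m = []
  paths (suc d) zero    m = []
  paths (suc d) (suc h) m =
    -- A down step has weight 1 and keeps the fuel but lowers the height; an up step raises or keeps
    -- the height but uses up a variable of `m`, hence one unit of fuel. Variables with index beyond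
    -- the length of `m` cannot divide it.
    [] ∷ map (down ∷_) (paths (suc d) h m) ++ concat (map (upPaths d (suc h) m) (upTo (length m)))

  upPaths : ℕ → ℕ → Monomial → ℕ → List Path
  upPaths d h m k = map (up k ∷_) (maybe′ (paths d (h ℕ.+ k)) [] (divideByVar k m))

paths-positive : ∀ d h m → All (Positive h) (paths d h m)
paths-positive zero    h       m = All.[]
paths-positive (suc d) zero    m = All.[]
paths-positive (suc d) (suc h) m = [] All.∷
  All.++⁺ (All.map⁺ (All.map down∷_ (paths-positive (suc d) h m)))
          (All.concat⁺ (All.map⁺ (All.universal
            (λ k → All.map⁺ (All.map up∷_ (rest k (divideByVar k m)))) (upTo (length m)))))
  where
  rest : ∀ k q → All (Positive (suc h ℕ.+ k)) (maybe′ (paths d (suc h ℕ.+ k)) [] q)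
  rest k nothing   = All.[]
  rest k (just m′) = paths-positive d (suc h ℕ.+ k) m′

map-∷-disjoint : ∀ {s s′ : Step} {Ps Qs} → s ≢ s′ → Disjoint (map (s ∷_) Ps) (map (s′ ∷_) Qs)
map-∷-disjoint s≢s′ (∈Ps , ∈Qs) with ∈-map⁻ _ ∈Ps | ∈-map⁻ _ ∈Qs
... | _ , _ , eq | _ , _ , eq′ = s≢s′ (∷-injectiveˡ (trans (sym eq) eq′))

up-injective : ∀ {j k} → up j ≡ up k → j ≡ k
up-injective refl = refl

paths-unique : ∀ d h m → Unique (paths d h m)
paths-unique zero    h       m = AllPairs.[]
paths-unique (suc d) zero    m = AllPairs.[]
paths-unique (suc d) (suc h) m =
  All.++⁺ (All.map⁺ (All.universal (λ _ ()) _))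
          (All.concat⁺ (All.map⁺ (All.universal (λ k → All.map⁺ (All.universal (λ _ ()) _)) ks)))
  AllPairs.∷
  Unique.++⁺ (Unique.map⁺ ∷-injectiveʳ (paths-unique (suc d) h m))
    (Unique.concat⁺
      (All.map⁺ (All.universal (λ k → Unique.map⁺ ∷-injectiveʳ (rest k (divideByVar k m))) ks))
      (AllPairs.map⁺ (AllPairs.map (λ j≢k {_} → map-∷-disjoint (j≢k ∘ up-injective))
                                   (Unique.upTo⁺ (length m)))))
    down#up
  where
  ks = upTo (length m)
  rest : ∀ k q → Unique (maybe′ (paths d (suc h ℕ.+ k)) [] q)
  rest k nothing   = AllPairs.[]
  rest k (just m′) = paths-unique d (suc h ℕ.+ k) m′
  down#up : Disjoint (map (down ∷_) (paths (suc d) h m)) (concat (map (upPaths d (suc h) m) ks))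
  down#up (∈downs , ∈ups) with ∈-concat⁻′ (map (upPaths d (suc h) m) ks) ∈ups
  ... | _ , ∈up , ∈map with ∈-map⁻ (upPaths d (suc h) m) ∈map
  ... | k , _ , refl = map-∷-disjoint (λ ()) (∈downs , ∈up)

-- A nonzero coefficient after an up step forces its variable to divide `m`; the rest of the path
-- then has a nonzero coefficient at the quotient, whose degree is one less.
paths-complete : ∀ d {h m} → sum m ℕ.< d → ∀ {P} → Positive h P →
                 coeff (weight P) m ≢ 0ℤ → P ∈ paths d h m
paths-complete (suc d) m<1+d {[]} [] ne = here refl
paths-complete (suc d) {m = m} m<1+d {down ∷ P} (down∷ p) ne =
  there (∈-++⁺ˡ (∈-map⁺ (down ∷_)
    (paths-complete (suc d) m<1+d p (ne ∘ trans (*-identityˡ (weight P) m)))))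
paths-complete (suc d) {suc h} {m} m<1+d {up k ∷ P} (up∷ p) ne =
  there (∈-++⁺ʳ (map (down ∷_) (paths (suc d) h m))
    (∈-concat⁺′ (∈-map⁺ (up k ∷_) (rest (divideByVar k m) refl))
                (∈-map⁺ (upPaths d (suc h) m) (∈-upTo⁺ (ℕ.≰⇒> (ne ∘ t₊-*-≥length (weight P) m))))))
  where
  rest : ∀ q → divideByVar k m ≡ q → P ∈ maybe′ (paths d (suc h ℕ.+ k)) [] q
  rest nothing eq =
    contradiction (trans (coeff-t₊-* k (weight P) m) (cong (maybe′ (coeff (weight P)) 0ℤ) eq)) ne
  rest (just m′) eq =
    paths-complete d (degree-divideByVar-< k m eq m<1+d) p
      (ne ∘ trans (trans (coeff-t₊-* k (weight P) m) (cong (maybe′ (coeff (weight P)) 0ℤ) eq)))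

sum-concat-map : ∀ {I J : Set} (f : J → ℤ) (g : I → List J) is →
                 sumℤ (map f (concat (map g is))) ≡ sumℤ (map (λ i → sumℤ (map f (g i))) is)
sum-concat-map f g []       = refl
sum-concat-map f g (i ∷ is) = begin
  sumℤ (map f (g i ++ concat (map g is)))                        ≡⟨ cong sumℤ (map-++ f (g i) _) ⟩
  sumℤ (map f (g i) ++ map f (concat (map g is)))                ≡⟨ sum-++ (map f (g i)) _ ⟩
  sumℤ (map f (g i)) ℤ.+ sumℤ (map f (concat (map g is)))        ≡⟨ cong (sumℤ (map f (g i)) ℤ.+_) (sum-concat-map f g is) ⟩
  sumℤ (map f (g i)) ℤ.+ sumℤ (map (λ j → sumℤ (map f (g j))) is) ∎
  where open ≡-Reasoning

-- From the first-step recursion to path sums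

module _ (E : ℕ → PowerSeries) (E-zero : E 0 ≈ 0#)
         (E-suc : ∀ h → E (suc h) ≈ 1# + E h + varSum (λ k → E (suc h ℕ.+ k))) where

  -- The recursions of `paths` and of `E` match term by term: the empty path, a down step, an up
  -- step. Listed paths of another weight need no removal, as their coefficient at `m` is 0.
  sum-paths : ∀ d h m → sum m ℕ.< d →
              sumℤ (map (λ P → coeff (weight P) m) (paths d h m)) ≡ coeff (E h) m
  sum-paths (suc d) zero    m m<1+d = sym (E-zero m)
  sum-paths (suc d) (suc h) m m<1+d = begin
    coeff 1# m ℤ.+ sumℤ (map w (downs ++ ups))
      ≡⟨ cong (λ xs → coeff 1# m ℤ.+ sumℤ xs) (map-++ w downs ups) ⟩
    coeff 1# m ℤ.+ sumℤ (map w downs ++ map w ups)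
      ≡⟨ cong (coeff 1# m ℤ.+_) (sum-++ (map w downs) (map w ups)) ⟩
    coeff 1# m ℤ.+ (sumℤ (map w downs) ℤ.+ sumℤ (map w ups))
      ≡⟨ ℤ.+-assoc (coeff 1# m) _ _ ⟨
    coeff 1# m ℤ.+ sumℤ (map w downs) ℤ.+ sumℤ (map w ups)
      ≡⟨ cong₂ (λ x y → coeff 1# m ℤ.+ x ℤ.+ y)
           (trans sum-downs (sum-paths (suc d) h m m<1+d)) sum-ups ⟩
    coeff 1# m ℤ.+ coeff (E h) m ℤ.+ coeff (varSum (λ k → E (suc h ℕ.+ k))) m
      ≡⟨ E-suc h m ⟨
    coeff (E (suc h)) m ∎
    where
    open ≡-Reasoning
    w : Path → ℤ
    w P = coeff (weight P) m
    downs = map (down ∷_) (paths (suc d) h m)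
    ups = concat (map (upPaths d (suc h) m) (upTo (length m)))

    sum-downs : sumℤ (map w downs) ≡ sumℤ (map w (paths (suc d) h m))
    sum-downs = begin
      sumℤ (map w downs)                                    ≡⟨ cong sumℤ (map-∘ (paths (suc d) h m)) ⟨
      sumℤ (map (w ∘ (down ∷_)) (paths (suc d) h m))        ≡⟨ cong sumℤ (map-cong (λ P → *-identityˡ (weight P) m) (paths (suc d) h m)) ⟩
      sumℤ (map w (paths (suc d) h m))                      ∎

    rest : ∀ k q → divideByVar k m ≡ q →
           sumℤ (map (λ P → maybe′ (coeff (weight P)) 0ℤ q) (maybe′ (paths d (suc h ℕ.+ k)) [] q)) ≡
           maybe′ (coeff (E (suc h ℕ.+ k))) 0ℤ q
    rest k nothing   eq = refl
    rest k (just m′) eq =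
      sum-paths d (suc h ℕ.+ k) m′ (degree-divideByVar-< k m eq m<1+d)

    sum-up : ∀ k → sumℤ (map w (upPaths d (suc h) m k)) ≡ coeff (t₊ k * E (suc h ℕ.+ k)) m
    sum-up k = begin
      sumℤ (map w (map (up k ∷_) Ps))
        ≡⟨ cong sumℤ (map-∘ Ps) ⟨
      sumℤ (map (w ∘ (up k ∷_)) Ps)
        ≡⟨ cong sumℤ (map-cong (λ P → coeff-t₊-* k (weight P) m) Ps) ⟩
      sumℤ (map (λ P → maybe′ (coeff (weight P)) 0ℤ (divideByVar k m)) Ps)
        ≡⟨ rest k (divideByVar k m) refl ⟩
      maybe′ (coeff (E (suc h ℕ.+ k))) 0ℤ (divideByVar k m)
        ≡⟨ coeff-t₊-* k (E (suc h ℕ.+ k)) m ⟨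
      coeff (t₊ k * E (suc h ℕ.+ k)) m ∎
      where Ps = maybe′ (paths d (suc h ℕ.+ k)) [] (divideByVar k m)

    sum-ups : sumℤ (map w ups) ≡ coeff (varSum (λ k → E (suc h ℕ.+ k))) m
    sum-ups = begin
      sumℤ (map w ups)
        ≡⟨ sum-concat-map w (upPaths d (suc h) m) (upTo (length m)) ⟩
      sumℤ (map (λ k → sumℤ (map w (upPaths d (suc h) m k))) (upTo (length m)))
        ≡⟨ cong sumℤ (map-cong sum-up (upTo (length m))) ⟩
      sumℤ (map (λ k → coeff (t₊ k * E (suc h ℕ.+ k)) m) (upTo (length m)))
        ≡⟨ coeff-sumBelow (λ k → t₊ k * E (suc h ℕ.+ k)) (length m) m ⟨
      coeff (varSum (λ k → E (suc h ℕ.+ k))) m ∎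

  nonnegative-hasSum : IsGeneratingFunction Nonnegative (E 1)
  nonnegative-hasSum m =
    paths d 1 m , paths-unique d 1 m ,
    All.map Positive-1⇒Nonnegative (paths-positive d 1 m) ,
    (λ P p ne → paths-complete d ℕ.≤-refl (Nonnegative⇒Positive-1 p) ne) ,
    sym (sum-paths d 1 m ℕ.≤-refl)
    where d = suc (sum m)

-- The Geode as a power series

module _ (S : PowerSeries) (S≈ : S ≈ S-operator S) where

  open FixedPoint (N-operator S) (N-operator-contractive S)
  open GeodeIdentities S (S ^_) (PS.refl {1#}) (λ n → PS.refl {S ^ suc n})
         varSum varSum-cong varSum-+ varSum-*ʳ S≈ fixedPoint fixedPoint-≈

  -- The factor `geometric S 1` equals 1. It is kept so that the series is literally the value at
  -- height 1 of the family to which `nonnegative-hasSum` is applied.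
  nonnegativeSeries : PowerSeries
  nonnegativeSeries = fixedPoint * geometric S 1

  nonnegativeSeries-generates : IsGeneratingFunction Nonnegative nonnegativeSeries
  nonnegativeSeries-generates =
    nonnegative-hasSum (λ h → fixedPoint * geometric S h) (PS.zeroʳ fixedPoint) n*geometric-suc

  geode≃nonnegativeSeries : geode S ≃ ι nonnegativeSeries
  geode≃nonnegativeSeries m = begin
    coeff ((S - 1#) * 1#) m                            ≡⟨ PS.*-identityʳ (S - 1#) m ⟩
    coeff (S - 1#) m                                   ≡⟨ geode-identity m ⟨
    coeff (nonnegativeSeries * varSum (const 1#)) m    ≡⟨ PS.*-congˡ {nonnegativeSeries} {S₁} {varSum (const 1#)} S₁-varSum m ⟨
    coeff (nonnegativeSeries * S₁) m                   ∎
    where open ≡-Reasoning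

theorem3p4 : ∃! _≈_ SatisfiesSEquation
    × (∀ S → SatisfiesSEquation S →
    Σ[ N ∈ PowerSeries ] IsGeneratingFunction Nonnegative N × geode S ≃ ι N)
theorem3p4 =
  (FixedS.fixedPoint , fixed⇒S-equation FixedS.fixedPoint-≈ ,
    λ {S} S-eq → FixedS.fixedPoint-unique {FixedS.fixedPoint} {S} FixedS.fixedPoint-≈ (S-equation⇒fixed S-eq)) ,
  λ S S-eq → let S≈ = S-equation⇒fixed S-eq in
    nonnegativeSeries S S≈ , nonnegativeSeries-generates S S≈ , geode≃nonnegativeSeries S S≈
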